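{- Let $t \ge 4$ be a rational number and let $G$ be a $t$-tough graph on $n \ge 3$ vertices. Suppose that $G$ is not Hamiltonian, but there exists $z \in V(G)$ such that $G - z$ has a Hamilton cycle $C$, and fix an orientation of $C$. Then for any distinct $x, y \in (N(z))^+$, we have $\deg(x) + \deg(y) < n - t$.
   Context: Graphs are simple, undirected and finite. Let $c(H)$ denote the number of components of a graph $H$. For a real number $t \ge 0$, $G$ is $t$-tough if $|S| \ge t \cdot c(G-S)$ for all $S \subseteq V(G)$ with $c(G-S) \ge 2$ (so complete graphs are $t$-tough for every $t$). A graph is Hamiltonian if it has a cycle containing all its vertices (a Hamilton cycle). $N(z)$ is the set of neighbors of $z$ in $G$, and $\deg$ denotes degree in $G$. For a cycle $C$ with a fixed orientation and $u \in V(C)$, $u^+$ is the immediate successor of $u$ on $C$ along the orientation; for $S \subseteq V(C)$, $S^+ = \{u^+ : u \in S\}$. Here $N(z) \subseteq V(G)\setminus\{z\} = V(C)$, so $(N(z))^+$ is well defined. -}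

module Defs where

open import Data.Fin.Base using (Fin; toℕ)
open import Data.Fin.Subset using (Subset; _∈_; ∁; ⁅_⁆; ∣_∣)
open import Data.Integer.Base using (+_)
open import Data.Nat.Base using (ℕ; suc; _+_; _≥_)
open import Data.Nat.DivMod using (_mod_)
open import Data.Product.Base using (Σ; ∃; _×_; proj₁)
open import Data.Rational.Base as ℚ using (ℚ)
open import Data.Rational.Literals using (fromℤ)
open import Data.Vec.Base using (tabulate)
open import Function.Base using (_∘_)
open import Function.Bundles using (_⇔_)
open import Function.Definitions using (Injective; StrictlySurjective)
open import Level using (0ℓ)
open import Relation.Binary.Construct.Closure.ReflexiveTransitive using (Star)
open import Relation.Binary.Core using (Rel)
open import Relation.Binary.Definitions using (Decidable; Symmetric)
open import Relation.Binary.PropositionalEquality using (_≡_)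
open import Relation.Nullary using (¬_; does)

ℕ→ℚ : ℕ → ℚ
ℕ→ℚ m = fromℤ (+ m)

record Graph (V : Set) : Set₁ where
  field
    Adj        : Rel V 0ℓ
    adj?       : Decidable Adj
    Adj-sym    : Symmetric Adj
    Adj-irrefl : ∀ {v} → ¬ Adj v v

open Graph public

module _ {n : ℕ} (G : Graph (Fin n)) where

  N : Fin n → Subset n
  N v = tabulate (does ∘ adj? G v)

  deg : Fin n → ℕ
  deg v = ∣ N v ∣

  -- Membership in a Subset is proof-irrelevant, so the vertices of the
  -- induced subgraph correspond exactly to the elements of W.
  _[_] : (W : Subset n) → Graph (Σ (Fin n) (_∈ W))
  _[_] W = record
    { Adj        = λ u v → Adj G (proj₁ u) (proj₁ v)
    ; adj?       = λ u v → adj? G (proj₁ u) (proj₁ v)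
    ; Adj-sym    = Adj-sym G
    ; Adj-irrefl = Adj-irrefl G
    }

  _─_ : (S : Subset n) → Graph (Σ (Fin n) (_∈ ∁ S))
  _─_ S = _[_] (∁ S)

  _-_ : (z : Fin n) → Graph (Σ (Fin n) (_∈ ∁ ⁅ z ⁆))
  _-_ z = _─_ ⁅ z ⁆

-- c(H) = k: the quotient of the vertices by the relation "joined by a
-- walk" is in bijection with Fin k.  This determines k.
ComponentCount : {V : Set} → Graph V → ℕ → Set
ComponentCount {V} H k =
  ∃ λ (component : V → Fin k) →
    StrictlySurjective _≡_ component ×
    (∀ u v → (component u ≡ component v) ⇔ Star (Adj H) u v)

Tough : {n : ℕ} → ℚ → Graph (Fin n) → Set
Tough {n} t G =
  (S : Subset n) (c : ℕ) → ComponentCount (G ─ S) c → c ≥ 2 →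
  ℕ→ℚ ∣ S ∣ ℚ.≥ t ℚ.* ℕ→ℚ c

next : {m : ℕ} → Fin (suc m) → Fin (suc m)
next {m} i = suc (toℕ i) mod suc m

-- The vertices are listed in cyclic order, so a Cycle carries an
-- orientation; reversing the list gives the opposite one.
record Cycle {V : Set} (H : Graph V) : Set where
  field
    excess    : ℕ
    vertex    : Fin (3 + excess) → V
    injective : Injective _≡_ _≡_ vertex
    adjacent  : ∀ i → Adj H (vertex i) (vertex (next i))

open Cycle public

IsHamilton : {V : Set} {H : Graph V} → Cycle H → Set
IsHamilton C = StrictlySurjective _≡_ (vertex C)

Hamiltonian : {V : Set} → Graph V → Set
Hamiltonian H = ∃ λ (C : Cycle H) → IsHamilton C

-- x ∈⁺[ C ] S means x ∈ S⁺, with successors taken along C; x and S live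
-- in the ambient vertex set Fin n.
_∈⁺[_]_ : {n : ℕ} {W : Subset n} {H : Graph (Σ (Fin n) (_∈ W))} →
          Fin n → Cycle H → Subset n → Set
x ∈⁺[ C ] S =
  ∃ λ i → proj₁ (vertex C i) ∈ S × x ≡ proj₁ (vertex C (next i))

{-# OPTIONS --safe #-}
module Submission where

-- The cycle C and the vertex z give a Hamilton path p₀ … p_N from x to y on which
-- z sits between a predecessor b ∼ y and a successor a ∼ x.  As G is not
-- Hamiltonian, no i has both x ∼ p_{i+1} (X) and y ∼ p_i (Y), so with g the
-- number of gaps, i.e. of i < N with neither, deg x + deg y ≤ n − 1 − g.  Let W
-- be the set of the K vertices w = p_{i+1} with Y at i and X at i + 1; z is one.
-- Rerouting through such a w shows that stepping from a neighbour of w one place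
-- along the path towards w leads to a vertex adjacent to neither x nor y, that W
-- is independent, and that two such neighbours of W cannot cross.  Counting
-- positions, the neighbourhood S of W satisfies |S| ≤ 2K + 3g, and
-- deg z ≤ 1 + K + g.  The elements of W and the component of x witness that
-- G − S has at least K + 1 components, so τ(K + 1) ≤ 2K + 3g and
-- 2τ ≤ 1 + K + g for every natural number τ ≤ t.  If deg x + deg y ≥ n − t, then
-- τ may be chosen with τ ≥ 4 and τ > g, and these inequalities conflict.

open import Defs
open import Algebra.Properties.CommutativeSemigroup using (interchange)
open import Data.Bool.Base using (if_then_else_)
open import Data.Empty using (⊥)
open import Data.Fin.Base using (Fin; zero; suc; toℕ; fromℕ<)
import Data.Fin.Properties as Fin
open import Data.Fin.Properties using (toℕ<n; toℕ-injective; toℕ-fromℕ<; injective⇒≤)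
open import Data.Fin.Subset using (Subset; _∈_; _∉_; ∁; ∣_∣; ⁅_⁆; inside; outside; Nonempty)
open import Data.Fin.Subset.Properties
  using (_∈?_; x∉p⇒x∈∁p; x∈∁p⇒x∉p; p⊆q⇒∣p∣≤∣q∣; ∣⁅x⁆∣≡1; x∈⁅y⁆⇒x≡y; x∈⁅x⁆)
import Data.Integer.Base as ℤ
import Data.Integer.Properties as ℤ
open import Data.List.Base as List using (List; []; _∷_; _++_; reverse; length; lookup; allFin)
import Data.List.Membership.Propositional as List
open import Data.List.Membership.Propositional.Properties using (∈-lookup; ∈-allFin)
open import Data.List.Membership.Propositional.Properties.WithK using (unique∧set⇒bag)
open import Data.List.Properties using (unfold-reverse; length-tabulate; map-tabulate)
open import Data.List.Relation.Binary.BagAndSetEquality using (∼bag⇒↭)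
open import Data.List.Relation.Binary.Permutation.Propositional
  using (_↭_; ↭-refl; ↭-trans; ↭-sym; ↭⇒↭ₛ; prep)
open import Data.List.Relation.Binary.Permutation.Propositional.Properties
  using (↭-reverse; ↭-length; ∈-resp-↭; ++⁺; map⁺; ++-commutativeMonoid)
import Data.List.Relation.Binary.Permutation.Setoid.Properties as PermutationSetoid
open import Data.List.Relation.Unary.All as All using (All)
open import Data.List.Relation.Unary.AllPairs using ([]; _∷_)
open import Data.List.Relation.Unary.Any using (here; there; index)
open import Data.List.Relation.Unary.Any.Properties using (lookup-index)
open import Data.List.Relation.Unary.Unique.Propositional using (Unique)
open import Data.List.Relation.Unary.Unique.Propositional.Properties using (allFin⁺)
open import Data.Nat.Base
open import Data.Nat.DivMod using (_%_; _mod_; m<n⇒m%n≡m; n%n≡0)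
open import Data.Nat.ListAction using (sum)
open import Data.Nat.ListAction.Properties using (sum-↭)
open import Data.Nat.Properties
open import Data.Nat.Solver using (module +-*-Solver)
open import Data.Product.Base using (Σ; ∃; _×_; _,_; proj₁; proj₂)
open import Data.Rational.Base as ℚ using (ℚ; *≤*)
import Data.Rational.Properties as ℚ
open import Data.Rational.Unnormalised.Base using (*≡*)
import Data.Rational.Unnormalised.Properties as ℚᵘ
open import Data.Sum.Base using (_⊎_; inj₁; inj₂; [_,_]′)
open import Data.Vec.Base as Vec using ([]; _∷_; tabulate)
open import Data.Vec.Properties using (lookup∘tabulate; []=⇒lookup; lookup⇒[]=)
open import Data.Vec.Properties.WithK using ([]=-irrelevant)
open import Function.Base using (_∘_; id; case_of_)
open import Function.Bundles using (_⇔_; mk⇔; module Equivalence)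
open import Function.Definitions using (Injective; StrictlySurjective)
open import Level using (0ℓ)
open import Relation.Binary.Construct.Closure.ReflexiveTransitive
  using (Star; ε; _◅_; _◅◅_) renaming (reverse to Star-reverse)
open import Relation.Binary.Core using (Rel)
open import Relation.Binary.Definitions using (tri<; tri≈; tri>)
open import Relation.Binary.PropositionalEquality
  using (_≡_; _≢_; refl; sym; trans; cong; cong₂; subst; subst₂; setoid)
open import Relation.Binary.Structures using (IsEquivalence)
open import Relation.Nullary.Decidable
  using (Dec; yes; no; does; _×-dec_; _⊎-dec_; ¬?; dec-true; dec-false;
         decidable-stable; ¬¬-excluded-middle)
open import Relation.Nullary.Negation using (¬_; contradiction)
open import Relation.Unary using (Pred; Decidable)

-- Cyclic successors, paths as vertex lists, and cycles from closed paths

toℕ-next-< : ∀ {m} (i : Fin (suc m)) → suc (toℕ i) < suc m → toℕ (next i) ≡ suc (toℕ i)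
toℕ-next-< i i<m = trans (toℕ-fromℕ< _) (m<n⇒m%n≡m i<m)

toℕ-next-last : ∀ {m} (i : Fin (suc m)) → suc (toℕ i) ≡ suc m → next i ≡ zero
toℕ-next-last {m} i eq =
  toℕ-injective (trans (toℕ-fromℕ< _) (trans (cong (_% suc m) eq) (n%n≡0 (suc m))))

Unique-resp-↭ : ∀ {A : Set} {xs ys : List A} → xs ↭ ys → Unique xs → Unique ys
Unique-resp-↭ {A} xs↭ys = PermutationSetoid.Unique-resp-↭ (setoid A) (↭⇒↭ₛ xs↭ys)

lookup-injective : ∀ {A : Set} {xs : List A} → Unique xs → Injective _≡_ _≡_ (lookup xs)
lookup-injective {xs = _ ∷ xs} _        {zero}  {zero}  _  = refl
lookup-injective {xs = _ ∷ xs} (x∉ ∷ _) {zero}  {suc j} eq =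
  contradiction eq (All.lookup x∉ (∈-lookup j))
lookup-injective {xs = _ ∷ xs} (x∉ ∷ _) {suc i} {zero}  eq =
  contradiction (sym eq) (All.lookup x∉ (∈-lookup i))
lookup-injective {xs = _ ∷ xs} (_ ∷ u)  {suc i} {suc j} eq = cong suc (lookup-injective u eq)

module _ {V : Set} (E : Rel V 0ℓ) where

  infixr 5 _∷_
  data Path : V → List V → V → Set where
    end : ∀ u → Path u (u ∷ []) u
    _∷_ : ∀ {u w xs v} → E u w → Path w xs v → Path u (u ∷ xs) v

  Path-++ : ∀ {u xs v w ys t} → Path u xs v → E v w → Path w ys t → Path u (xs ++ ys) t
  Path-++ (end _) e′ q = e′ ∷ q
  Path-++ (e ∷ p) e′ q = e ∷ Path-++ p e′ q

  Path-reverse : (∀ {u v} → E u v → E v u) →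
                 ∀ {u xs v} → Path u xs v → Path v (reverse xs) u
  Path-reverse s (end u) = end u
  Path-reverse s (_∷_ {u} {xs = xs} e p) =
    subst (λ zs → Path _ zs u) (sym (unfold-reverse u xs))
      (Path-++ (Path-reverse s p) (s e) (end u))

  lookup-step : ∀ {u xs v} → Path u xs v → (i j : Fin (length xs)) → toℕ j ≡ suc (toℕ i) →
                E (lookup xs i) (lookup xs j)
  lookup-step (end _)     zero    zero       ()
  lookup-step (e ∷ end _) zero    (suc zero) _  = e
  lookup-step (e ∷ _ ∷ _) zero    (suc zero) _  = e
  lookup-step (_ ∷ p)     (suc i) (suc j)    eq = lookup-step p i j (suc-injective eq)

  lookup-last : ∀ {u xs v} → Path u xs v → (i : Fin (length xs)) → suc (toℕ i) ≡ length xs →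
                lookup xs i ≡ v
  lookup-last (end _)     zero    _  = refl
  lookup-last (_ ∷ end _) zero    ()
  lookup-last (_ ∷ _ ∷ _) zero    ()
  lookup-last (_ ∷ p)     (suc i) eq = lookup-last p i (suc-injective eq)

  lookup-head : ∀ {u x xs v} → Path u (x ∷ xs) v → x ≡ u
  lookup-head (end _) = refl
  lookup-head (_ ∷ _) = refl

  lookup-next : ∀ {u x xs v} → Path u (x ∷ xs) v → E v u → (i : Fin (suc (length xs))) →
                E (lookup (x ∷ xs) i) (lookup (x ∷ xs) (next i))
  lookup-next {xs = xs} p close i with suc (toℕ i) <? suc (length xs)
  ... | yes i<  = lookup-step p i (next i) (toℕ-next-< i i<)
  -- At the last index `next` returns `zero`, so the edge needed is the closing one.
  ... | no  i≮ with last ← ≤-antisym (toℕ<n i) (≮⇒≥ i≮)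
    rewrite toℕ-next-last i last | lookup-last p i last | lookup-head p = close

module _ {n : ℕ} (G : Graph (Fin n)) where

  -- The order of the inner vertices is forgotten: a Hamilton cycle assembled
  -- from routes only has to be checked to visit every vertex once.
  Route : Fin n → Fin n → List (Fin n) → Set
  Route u v S = ∃ λ xs → Path (Adj G) u xs v × xs ↭ S

  infixr 5 _⟨_⟩_

  _⟨_⟩_ : ∀ {u v w t S T} → Route u v S → Adj G v w → Route w t T → Route u t (S ++ T)
  (_ , p , s) ⟨ e ⟩ (_ , q , t) = _ , Path-++ _ p e q , ++⁺ s t

  rev : ∀ {u v S} → Route u v S → Route v u S
  rev (xs , p , s) = _ , Path-reverse _ (Adj-sym G) p , ↭-trans (↭-reverse xs) s

  closed-route⇒Hamiltonian : ∀ {u v S} → n ≥ 3 → S ↭ allFin n → Route u v S → Adj G v u →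
                             Hamiltonian G
  closed-route⇒Hamiltonian n≥3 σ (xs , p , τ) close = go xs p close (↭-trans τ σ)
    (subst (_≥ 3) (sym (trans (↭-length (↭-trans τ σ)) (length-tabulate (λ i → i)))) n≥3)
    where
    go : ∀ xs {u v} → Path (Adj G) u xs v → Adj G v u → xs ↭ allFin n → length xs ≥ 3 →
         Hamiltonian G
    go []              _ _     _ ()
    go (_ ∷ [])        _ _     _ (s≤s ())
    go (_ ∷ _ ∷ [])    _ _     _ (s≤s (s≤s ()))
    go xs@(_ ∷ _ ∷ _ ∷ ys) p close π _ =
      record
        { excess    = length ys
        ; vertex    = lookup xs
        ; injective = lookup-injective (Unique-resp-↭ (↭-sym π) (allFin⁺ n))
        ; adjacent  = lookup-next (Adj G) p close
        } ,
      λ v → let v∈xs = ∈-resp-↭ (↭-sym π) (∈-allFin v) in index v∈xs , sym (lookup-index v∈xs)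

-- Blocks of consecutive terms of a sequence, and paths as sequences

module _ {V : Set} (p : ℕ → V) where

  -- Seg i j S : S lists p i, p (suc i), …, p j (so i ≤ j).
  data Seg : ℕ → ℕ → List V → Set where
    single : ∀ i → Seg i i (p i ∷ [])
    _◂_    : ∀ i {j S} → Seg (suc i) j S → Seg i j (p i ∷ S)

  Seg-++ : ∀ {i j k S T} → Seg i j S → Seg (suc j) k T → Seg i k (S ++ T)
  Seg-++ (single i) t = i ◂ t
  Seg-++ (i ◂ s)    t = i ◂ Seg-++ s t

  segment : ∀ {i j} → i ≤′ j → ∃ (Seg i j)
  segment (≤′-reflexive refl) = _ , single _
  segment (≤′-step i≤j)       = _ , Seg-++ (proj₂ (segment i≤j)) (single _)

  Seg⇒≤ : ∀ {i j S} → Seg i j S → i ≤ j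
  Seg⇒≤ (single i) = ≤-refl
  Seg⇒≤ (i ◂ s)    = <⇒≤ (Seg⇒≤ s)

  Seg-unique : ∀ {i j S T} → Seg i j S → Seg i j T → S ≡ T
  Seg-unique (single _) (single _) = refl
  Seg-unique (single _) (_ ◂ t)    = contradiction (Seg⇒≤ t) (<-irrefl refl)
  Seg-unique (_ ◂ s)    (single _) = contradiction (Seg⇒≤ s) (<-irrefl refl)
  Seg-unique (_ ◂ s)    (_ ◂ t)    = cong (p _ ∷_) (Seg-unique s t)

  Seg-∈ : ∀ {i j k S} → Seg i j S → i ≤ k → k ≤ j → p k List.∈ S
  Seg-∈ {k = k} (single i) i≤k k≤i rewrite ≤-antisym i≤k k≤i = here refl
  Seg-∈ {k = k} (i ◂ s) i≤k k≤j with m≤n⇒m<n∨m≡n i≤k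
  ... | inj₁ i<k  = there (Seg-∈ s i<k k≤j)
  ... | inj₂ refl = here refl

  Seg-All : ∀ {Q : V → Set} {i j S} → Seg i j S → (∀ {k} → i ≤ k → k ≤ j → Q (p k)) → All Q S
  Seg-All (single i) q = q ≤-refl ≤-refl All.∷ All.[]
  Seg-All (i ◂ s)    q = q ≤-refl (<⇒≤ (Seg⇒≤ s)) All.∷ Seg-All s (q ∘ <⇒≤)

  Seg-Unique : ∀ {i j S} → Seg i j S → (∀ {k l} → k < l → l ≤ j → p k ≢ p l) → Unique S
  Seg-Unique (single i) _ = All.[] ∷ []
  Seg-Unique (i ◂ s)    d = Seg-All s d ∷ Seg-Unique s d

  Seg-length : ∀ {i j S} → Seg i j S → length S + i ≡ suc j
  Seg-length (single i)           = refl
  Seg-length {S = _ ∷ S} (i ◂ s) = trans (sym (+-suc (length S) i)) (Seg-length s)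

  Seg⇒Path : ∀ {E : Rel V 0ℓ} {i j S} → (∀ {k} → k < j → E (p k) (p (suc k))) → Seg i j S →
             Path E (p i) S (p j)
  Seg⇒Path e (single _) = end _
  Seg⇒Path e (i ◂ s)    = e (Seg⇒≤ s) ∷ Seg⇒Path e s

Seg-suc : ∀ {V : Set} {p : ℕ → V} {i j S} → Seg (p ∘ suc) i j S → Seg p (suc i) (suc j) S
Seg-suc (single i) = single (suc i)
Seg-suc (i ◂ s)    = suc i ◂ Seg-suc s

Seg-pred : ∀ {V : Set} {p : ℕ → V} {i j S} → Seg p (suc i) (suc j) S → Seg (p ∘ suc) i j S
Seg-pred (single (suc i)) = single i
Seg-pred (suc i ◂ s)      = i ◂ Seg-pred s

module _ {V : Set} {E : Rel V 0ℓ} where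

  -- Beyond the end the last vertex is repeated, which makes a path a total sequence on `ℕ`.
  at : ∀ {u xs v} → Path E u xs v → ℕ → V
  at (end u)          _       = u
  at (_∷_ {u = u} _ _) zero    = u
  at (_ ∷ p)          (suc k) = at p k

  steps : ∀ {u xs v} → Path E u xs v → ℕ
  steps (end _) = 0
  steps (_ ∷ p) = suc (steps p)

  at-head : ∀ {u xs v} (p : Path E u xs v) → at p 0 ≡ u
  at-head (end _) = refl
  at-head (_ ∷ _) = refl

  at-last : ∀ {u xs v} (p : Path E u xs v) → at p (steps p) ≡ v
  at-last (end _) = refl
  at-last (_ ∷ p) = at-last p

  at-step : ∀ {u xs v} (p : Path E u xs v) {k} → k < steps p → E (at p k) (at p (suc k))
  at-step (e ∷ p) {zero}  _       = subst (E _) (sym (at-head p)) e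
  at-step (_ ∷ p) {suc k} (s≤s k<) = at-step p k<

  at-Seg : ∀ {u xs v} (p : Path E u xs v) → Seg (at p) 0 (steps p) xs
  at-Seg (end u) = single 0
  at-Seg (e ∷ p) = 0 ◂ Seg-suc (at-Seg p)

  at-junction : ∀ {u xs b z a ys v} (p : Path E u xs b) (e : E b z) (e′ : E z a)
                (q : Path E a ys v) → let π = Path-++ E p e (e′ ∷ q) in
                ∃ λ s → at π s ≡ b × at π (1 + s) ≡ z × at π (2 + s) ≡ a × 2 + s ≤ steps π
  at-junction (end _) e e′ q = 0 , refl , refl , at-head q , s≤s (s≤s z≤n)
  at-junction (_ ∷ p) e e′ q with s , b≡ , z≡ , a≡ , s≤ ← at-junction p e e′ q =
    suc s , b≡ , z≡ , a≡ , s≤s s≤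

-- Counting the positions at which a decidable predicate holds

⟦_⟧ : ∀ {P : Set} → Dec P → ℕ
⟦ d ⟧ = if does d then 1 else 0

⟦⟧-⊎ : ∀ {P Q R : Set} (P? : Dec P) (Q? : Dec Q) (R? : Dec R) → (P → Q ⊎ R) →
       ⟦ P? ⟧ ≤ ⟦ Q? ⟧ + ⟦ R? ⟧
⟦⟧-⊎ (no _)  _       _       _ = z≤n
⟦⟧-⊎ (yes _) (yes _) _       _ = s≤s z≤n
⟦⟧-⊎ (yes _) (no _)  (yes _) _ = s≤s z≤n
⟦⟧-⊎ (yes p) (no ¬q) (no ¬r) f with f p
... | inj₁ q = contradiction q ¬q
... | inj₂ r = contradiction r ¬r

⟦⟧-disjoint : ∀ {P Q R : Set} (P? : Dec P) (Q? : Dec Q) (R? : Dec R) →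
              (P → ¬ Q) → (P → R) → (Q → R) → ⟦ P? ⟧ + ⟦ Q? ⟧ ≤ ⟦ R? ⟧
⟦⟧-disjoint (yes p) (yes q) _       d _ _ = contradiction q (d p)
⟦⟧-disjoint (yes p) (no _)  (yes _) _ _ _ = ≤-refl
⟦⟧-disjoint (yes p) (no _)  (no ¬r) _ f _ = contradiction (f p) ¬r
⟦⟧-disjoint (no _)  (yes _) (yes _) _ _ _ = ≤-refl
⟦⟧-disjoint (no _)  (yes q) (no ¬r) _ _ g = contradiction (g q) ¬r
⟦⟧-disjoint (no _)  (no _)  _       _ _ _ = z≤n

# : ℕ → {P : Pred ℕ 0ℓ} → Decidable P → ℕ
# zero    P? = 0
# (suc n) P? = ⟦ P? 0 ⟧ + # n (P? ∘ suc)

#-⊎ : ∀ n {P Q R : Pred ℕ 0ℓ} (P? : Decidable P) (Q? : Decidable Q) (R? : Decidable R) →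
      (∀ i → i < n → P i → Q i ⊎ R i) → # n P? ≤ # n Q? + # n R?
#-⊎ zero    P? Q? R? f = z≤n
#-⊎ (suc n) P? Q? R? f = ≤-trans
  (+-mono-≤ (⟦⟧-⊎ (P? 0) (Q? 0) (R? 0) (f 0 z<s))
            (#-⊎ n (P? ∘ suc) (Q? ∘ suc) (R? ∘ suc) (λ i i<n → f (suc i) (s≤s i<n))))
  (≤-reflexive (interchange +-commutativeSemigroup ⟦ Q? 0 ⟧ ⟦ R? 0 ⟧ _ _))

#-disjoint : ∀ n {P Q R : Pred ℕ 0ℓ} (P? : Decidable P) (Q? : Decidable Q) (R? : Decidable R) →
             (∀ i → P i → ¬ Q i) → (∀ i → P i → R i) → (∀ i → Q i → R i) →
             # n P? + # n Q? ≤ # n R?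
#-disjoint zero    P? Q? R? d f g = z≤n
#-disjoint (suc n) P? Q? R? d f g = ≤-trans
  (≤-reflexive (interchange +-commutativeSemigroup ⟦ P? 0 ⟧ _ ⟦ Q? 0 ⟧ _))
  (+-mono-≤ (⟦⟧-disjoint (P? 0) (Q? 0) (R? 0) (d 0) (f 0) (g 0))
            (#-disjoint n (P? ∘ suc) (Q? ∘ suc) (R? ∘ suc) (d ∘ suc) (f ∘ suc) (g ∘ suc)))

#-mono : ∀ n {P Q : Pred ℕ 0ℓ} (P? : Decidable P) (Q? : Decidable Q) → (∀ i → i < n → P i → Q i) →
         # n P? ≤ # n Q?
#-mono zero    P? Q? f = z≤n
#-mono (suc n) P? Q? f = +-mono-≤ (head (P? 0) (Q? 0) (f 0 (s≤s z≤n)))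
                                  (#-mono n (P? ∘ suc) (Q? ∘ suc) (λ i i<n → f (suc i) (s≤s i<n)))
  where
  head : ∀ {A B : Set} (A? : Dec A) (B? : Dec B) → (A → B) → ⟦ A? ⟧ ≤ ⟦ B? ⟧
  head (no _)  _       _ = z≤n
  head (yes _) (yes _) _ = ≤-refl
  head (yes a) (no ¬b) h = contradiction (h a) ¬b

#-empty : ∀ n {P : Pred ℕ 0ℓ} (P? : Decidable P) → (∀ i → ¬ P i) → # n P? ≡ 0
#-empty zero    P? ¬P = refl
#-empty (suc n) P? ¬P rewrite dec-false (P? 0) (¬P 0) = #-empty n (P? ∘ suc) (¬P ∘ suc)

#-bounded : ∀ m n {P : Pred ℕ 0ℓ} (P? : Decidable P) → (∀ i → P i → i < n) → # m P? ≤ # n P?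
#-bounded zero    n       P? _  = z≤n
#-bounded (suc m) zero    P? P< = ≤-reflexive (#-empty (suc m) P? (λ i p → n≮0 (P< i p)))
#-bounded (suc m) (suc n) P? P< =
  +-monoʳ-≤ ⟦ P? 0 ⟧ (#-bounded m n (P? ∘ suc) (λ i p → s≤s⁻¹ (P< (suc i) p)))

#≤ : ∀ n {P : Pred ℕ 0ℓ} (P? : Decidable P) → # n P? ≤ n
#≤ zero    P? = z≤n
#≤ (suc n) P? with P? 0
... | yes _ = s≤s (#≤ n (P? ∘ suc))
... | no  _ = m≤n⇒m≤1+n (#≤ n (P? ∘ suc))

#-singleton : ∀ n s → # n (s ≟_) ≤ 1
#-singleton zero    s       = z≤n
#-singleton (suc n) zero    = ≤-reflexive (cong suc (#-empty n (λ i → zero ≟ suc i) (λ _ ())))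
#-singleton (suc n) (suc s) = ≤-trans
  (#-mono n (λ i → suc s ≟ suc i) (s ≟_) (λ _ _ → suc-injective)) (#-singleton n s)

-- Translates positions by one. As nothing holds at 0, `# (suc n) (↑? P?)` computes to `# n P?`;
-- several counts below pass from `suc N` to `N` by this reduction alone.
↑ : Pred ℕ 0ℓ → Pred ℕ 0ℓ
↑ P zero    = ⊥
↑ P (suc i) = P i

↑? : ∀ {P} → Decidable P → Decidable (↑ P)
↑? P? zero    = no id
↑? P? (suc i) = P? i

#-suc : ∀ n {P : Pred ℕ 0ℓ} (P? : Decidable P) → # n P? ≤ # (suc n) P?
#-suc zero    P? = z≤n
#-suc (suc n) P? = +-monoʳ-≤ ⟦ P? 0 ⟧ (#-suc n (P? ∘ suc))

#-↑ : ∀ n {P : Pred ℕ 0ℓ} (P? : Decidable P) → # n (↑? P?) ≤ # n P?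
#-↑ zero    P? = z≤n
#-↑ (suc n) P? = #-suc n P?

#-shift : ∀ n {P : Pred ℕ 0ℓ} (P? : Decidable P) → (∀ i → P i → i < n) →
          # n (P? ∘ suc) ≤ # n P?
#-shift n P? P< = ≤-trans (m≤n+m _ ⟦ P? 0 ⟧) (#-bounded (suc n) n P? P<)

-- Vertex sets: cardinality along a sequence, and membership

∣∣≡sum : ∀ {n} (T : Subset n) → ∣ T ∣ ≡ sum (List.map (λ v → ⟦ v ∈? T ⟧) (allFin n))
∣∣≡sum {n} T = trans (go T) (cong sum (sym (map-tabulate id (λ v → ⟦ v ∈? T ⟧))))
  where
  go : ∀ {n} (T : Subset n) → ∣ T ∣ ≡ sum (List.tabulate (λ v → ⟦ v ∈? T ⟧))
  go []            = refl
  go (inside  ∷ T) = cong suc (go T)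
  go (outside ∷ T) = go T

-- A sum of indicators over all vertices does not depend on their order, so a cardinality can be
-- computed along any sequence that visits every vertex once.
∣∣≡# : ∀ {n m S} (p : ℕ → Fin n) → Seg p 0 m S → S ↭ allFin n → (T : Subset n) →
       ∣ T ∣ ≡ # (suc m) (λ k → p k ∈? T)
∣∣≡# {n} p s σ T = trans (∣∣≡sum T) (trans (sym (sum-↭ (map⁺ _ σ))) (go p s))
  where
  go : ∀ p {m S} → Seg p 0 m S → sum (List.map (λ v → ⟦ v ∈? T ⟧) S) ≡ # (suc m) (λ k → p k ∈? T)
  go p         (single _) = refl
  go p {suc m} (_ ◂ s)    = cong (⟦ p 0 ∈? T ⟧ +_) (go (p ∘ suc) (Seg-pred s))
  go p {zero}  (_ ◂ s)    = contradiction (Seg⇒≤ p s) λ ()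

module _ {n : ℕ} {P : Pred (Fin n) 0ℓ} (P? : Decidable P) where

  ∈-tabulate⁺ : ∀ {v} → P v → v ∈ tabulate (does ∘ P?)
  ∈-tabulate⁺ {v} p =
    lookup⇒[]= v _ (trans (lookup∘tabulate (does ∘ P?) v) (dec-true (P? v) p))

  ∈-tabulate⁻ : ∀ {v} → v ∈ tabulate (does ∘ P?) → P v
  ∈-tabulate⁻ {v} v∈ with P? v in eq
  ... | yes p = p
  ... | no ¬p
    with () ← trans (sym ([]=⇒lookup v∈)) (trans (lookup∘tabulate (does ∘ P?) v) (cong does eq))

-- Components and toughness

enumerate : ∀ {n} (I : Subset n) →
            ∃ λ (e : Fin ∣ I ∣ → Fin n) → Injective _≡_ _≡_ e × (∀ a → e a ∈ I)
enumerate [] = (λ ()) , (λ {}) , λ ()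
enumerate (outside ∷ I) with e , inj , e∈ ← enumerate I =
  suc ∘ e , inj ∘ Fin.suc-injective , Vec.there ∘ e∈
enumerate {suc n} (inside ∷ I) with e , inj , e∈ ← enumerate I = e′ , inj′ , e′∈
  where
  e′ : Fin (suc ∣ I ∣) → Fin (suc n)
  e′ zero    = zero
  e′ (suc a) = suc (e a)
  inj′ : Injective _≡_ _≡_ e′
  inj′ {zero}  {zero}  _  = refl
  inj′ {suc _} {suc _} eq = cong suc (inj (Fin.suc-injective eq))
  e′∈ : ∀ a → e′ a ∈ inside ∷ I
  e′∈ zero    = Vec.here
  e′∈ (suc a) = Vec.there (e∈ a)

-- Reachability is not decided here, hence the double negation.
¬¬-quotient : ∀ {n} (W : Subset n) {_∼_ : Rel (Σ (Fin n) (_∈ W)) 0ℓ} → IsEquivalence _∼_ →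
              ¬ ¬ ∃ λ k → ∃ λ (class : Σ (Fin n) (_∈ W) → Fin k) →
                StrictlySurjective _≡_ class × (∀ u v → (class u ≡ class v) ⇔ (u ∼ v))
¬¬-quotient [] _ ¬q = ¬q (0 , (λ ()) , (λ ()) , λ ())
¬¬-quotient (outside ∷ W) {_∼_} equiv ¬q =
  ¬¬-quotient W {λ u v → lift u ∼ lift v}
    (record { refl = E.refl ; sym = E.sym ; trans = E.trans })
    λ (k , class , surj , iff) → ¬q
      (k , (λ where (suc v , Vec.there v∈) → class (v , v∈)) ,
       (λ c → let u , eq = surj c in lift u , eq) ,
       λ where (suc u , Vec.there u∈) (suc v , Vec.there v∈) → iff (u , u∈) (v , v∈))
  where
  module E = IsEquivalence equiv
  lift : Σ (Fin _) (_∈ W) → Σ (Fin _) (_∈ outside ∷ W)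
  lift (v , v∈) = suc v , Vec.there v∈
¬¬-quotient (inside ∷ W) {_∼_} equiv ¬q =
  ¬¬-quotient W {λ u v → lift u ∼ lift v}
    (record { refl = E.refl ; sym = E.sym ; trans = E.trans })
    λ (k , class , surj , iff) →
    ¬¬-excluded-middle {A = ∃ λ w → (zero , Vec.here) ∼ lift w} λ where
      (yes (w , 0∼w)) → ¬q (k , old class w ,
        (λ c → let u , eq = surj c in lift u , eq) , old-iff class iff w 0∼w)
      (no 0≁)         → ¬q (suc k , new class , new-surj class surj , new-iff class iff 0≁)
  where
  module E = IsEquivalence equiv
  V = Σ (Fin _) (_∈ W)
  V⁺ = Σ (Fin _) (_∈ inside ∷ W)
  lift : V → V⁺
  lift (v , v∈) = suc v , Vec.there v∈
  module _ {k} (class : V → Fin k) where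
    old : V → V⁺ → Fin k
    old w (zero  , _)            = class w
    old w (suc v , Vec.there v∈) = class (v , v∈)
    new : V⁺ → Fin (suc k)
    new (zero  , _)            = zero
    new (suc v , Vec.there v∈) = suc (class (v , v∈))
    new-surj : StrictlySurjective _≡_ class → StrictlySurjective _≡_ new
    new-surj surj zero    = (zero , Vec.here) , refl
    new-surj surj (suc c) = let u , eq = surj c in lift u , cong suc eq
    module _ (iff : ∀ u v → (class u ≡ class v) ⇔ (lift u ∼ lift v)) where
      to : ∀ u v → class u ≡ class v → lift u ∼ lift v
      to u v = Equivalence.to (iff u v)
      from : ∀ u v → lift u ∼ lift v → class u ≡ class v
      from u v = Equivalence.from (iff u v)
      old-iff : ∀ w → (zero , Vec.here) ∼ lift w → ∀ u v → (old w u ≡ old w v) ⇔ (u ∼ v)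
      old-iff w 0∼w (zero  , Vec.here)     (zero  , Vec.here)     = mk⇔ (λ _ → E.refl) (λ _ → refl)
      old-iff w 0∼w (zero  , Vec.here)     (suc v , Vec.there v∈) =
        mk⇔ (λ eq → E.trans 0∼w (to w _ eq)) (λ 0∼v → from w _ (E.trans (E.sym 0∼w) 0∼v))
      old-iff w 0∼w (suc u , Vec.there u∈) (zero  , Vec.here)     =
        mk⇔ (λ eq → E.trans (to _ w eq) (E.sym 0∼w)) (λ u∼0 → from _ w (E.trans u∼0 0∼w))
      old-iff w 0∼w (suc u , Vec.there u∈) (suc v , Vec.there v∈) = iff _ _
      new-iff : ¬ (∃ λ w → (zero , Vec.here) ∼ lift w) → ∀ u v → (new u ≡ new v) ⇔ (u ∼ v)
      new-iff 0≁ (zero  , Vec.here)     (zero  , Vec.here)     = mk⇔ (λ _ → E.refl) (λ _ → refl)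
      new-iff 0≁ (zero  , Vec.here)     (suc v , Vec.there v∈) =
        mk⇔ (λ ()) (λ 0∼v → contradiction (_ , 0∼v) 0≁)
      new-iff 0≁ (suc u , Vec.there u∈) (zero  , Vec.here)     =
        mk⇔ (λ ()) (λ u∼0 → contradiction (_ , E.sym u∼0) 0≁)
      new-iff 0≁ (suc u , Vec.there u∈) (suc v , Vec.there v∈) =
        mk⇔ (to _ _ ∘ Fin.suc-injective) (cong suc ∘ from _ _)

module _ {n : ℕ} (G : Graph (Fin n)) where

  ¬¬-ComponentCount : (S : Subset n) → ¬ ¬ ∃ (ComponentCount (G ─ S))
  ¬¬-ComponentCount S = ¬¬-quotient (∁ S)
    (record { refl = ε ; sym = Star-reverse (Adj-sym G) ; trans = _◅◅_ })

  -- A natural number in place of `t` keeps the counting in `ℕ`; the rational `t` returns only when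
  -- `τ` is chosen, at the very end.
  ToughAt : ℕ → Set
  ToughAt τ = (S : Subset n) (c : ℕ) → ComponentCount (G ─ S) c → c ≥ 2 → τ * c ≤ ∣ S ∣

  -- Deleting `S` isolates every vertex of `I`, since a walk from it has no first step. The elements
  -- of `I` and the further vertex `u` thus lie in distinct components, of which there are at least
  -- two because `I` is nonempty.
  isolated-bound : ∀ {τ} → ToughAt τ → (I S : Subset n) → Nonempty I →
                   (∀ {i} → i ∈ I → i ∉ S) → (∀ {i v} → i ∈ I → Adj G i v → v ∈ S) →
                   (u : Fin n) → u ∉ I → u ∉ S → τ * suc ∣ I ∣ ≤ ∣ S ∣
  isolated-bound {τ} tough I S (i , i∈) I∩S N[I]⊆S u u∉I u∉S =
    -- The goal is a decidable inequality, so a component count known only up to double negation is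
    -- enough.
    decidable-stable (_ ≤? _) λ ¬bound → ¬¬-ComponentCount S λ (c , cc) →
      ¬bound (≤-trans (*-monoʳ-≤ τ (count cc))
        (tough S c cc (≤-trans (s≤s ∣I∣≥1) (count cc))))
    where
    ∣I∣≥1 : ∣ I ∣ ≥ 1
    ∣I∣≥1 = subst (_≤ ∣ I ∣) (∣⁅x⁆∣≡1 i)
      (p⊆q⇒∣p∣≤∣q∣ λ j∈ → subst (_∈ I) (sym (x∈⁅y⁆⇒x≡y i j∈)) i∈)
    e = proj₁ (enumerate I)
    e-injective = proj₁ (proj₂ (enumerate I))
    e∈ = proj₂ (proj₂ (enumerate I))
    f : Fin (suc ∣ I ∣) → Σ (Fin n) (_∈ ∁ S)
    f zero    = u , x∉p⇒x∈∁p u∉S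
    f (suc a) = e a , x∉p⇒x∈∁p (I∩S (e∈ a))
    stuck : ∀ {a w} → Star (Adj (G ─ S)) (f (suc a)) w → e a ≡ proj₁ w
    stuck ε = refl
    stuck {a} (_◅_ {j = v , v∈} adj _) = contradiction (N[I]⊆S (e∈ a) adj) (x∈∁p⇒x∉p v∈)
    count : ∀ {c} → ComponentCount (G ─ S) c → suc ∣ I ∣ ≤ c
    count (class , _ , iff) = injective⇒≤ inj
      where
      inj : Injective _≡_ _≡_ (class ∘ f)
      inj {zero}  {zero}  _  = refl
      inj {suc a} {suc b} eq = cong suc (e-injective (stuck (Equivalence.to (iff _ _) eq)))
      inj {suc a} {zero}  eq =
        contradiction (subst (_∈ I) (stuck (Equivalence.to (iff _ _) eq)) (e∈ a)) u∉I
      inj {zero}  {suc b} eq =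
        contradiction (subst (_∈ I) (stuck (Equivalence.to (iff _ _) (sym eq))) (e∈ b)) u∉I

-- First τ + τ ≤ k + (g + 1) ≤ k + τ, so 4 ≤ τ ≤ k. Split τ(k + 1) as 3τ + τ(k - 2), which is at
-- least 3τ + 4(k - 2). The upper bound 3g + 2k is at most 3τ - 3 + 2k, so 4k - 8 ≤ 2k - 3, which
-- fails for k ≥ 4.
bounds-incompatible : ∀ {τ k g} → 4 ≤ τ → g < τ → τ * 2 ≤ 1 + (k + g) →
                      ¬ τ * suc k ≤ g + ((k + g) + (k + g))
bounds-incompatible {τ} {k} {g} 4≤τ g<τ 2τ≤ τ[1+k]≤ = for-4+ (m≤n⇒∃[o]m+o≡n (≤-trans 4≤τ τ≤k))
  where
  open ≤-Reasoning
  open +-*-Solver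
  τ≤k : τ ≤ k
  τ≤k = +-cancelʳ-≤ τ τ k (begin
    τ + τ       ≡⟨ solve 1 (λ t → t :+ t := t :* con 2) refl τ ⟩
    τ * 2       ≤⟨ 2τ≤ ⟩
    1 + (k + g) ≡⟨ +-suc k g ⟨
    k + suc g   ≤⟨ +-monoʳ-≤ k g<τ ⟩
    k + τ       ∎)
  for-4+ : ¬ ∃ λ i → 4 + i ≡ k
  for-4+ (i , refl) = m+n≮m (8 + 2 * i) (2 + 2 * i) (+-cancelˡ-≤ (3 * τ) _ _ (begin
    3 * τ + suc (8 + 2 * i + (2 + 2 * i))
      ≡⟨ solve 2 (λ t j →
           con 3 :* t :+ (con 1 :+ (con 8 :+ con 2 :* j :+ (con 2 :+ con 2 :* j))) :=
           con 3 :* t :+ con 4 :* (con 2 :+ j) :+ con 3) refl τ i ⟩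
    3 * τ + 4 * (2 + i) + 3
      ≤⟨ +-monoˡ-≤ 3 (+-monoʳ-≤ (3 * τ) (*-monoˡ-≤ (2 + i) 4≤τ)) ⟩
    3 * τ + τ * (2 + i) + 3
      ≡⟨ solve 2 (λ t j →
           con 3 :* t :+ t :* (con 2 :+ j) :+ con 3 := t :* (con 5 :+ j) :+ con 3) refl τ i ⟩
    τ * (5 + i) + 3                       ≤⟨ +-monoˡ-≤ 3 τ[1+k]≤ ⟩
    g + ((4 + i + g) + (4 + i + g)) + 3
      ≡⟨ solve 2 (λ h j →
           h :+ ((con 4 :+ j :+ h) :+ (con 4 :+ j :+ h)) :+ con 3 :=
           con 3 :* (con 1 :+ h) :+ (con 8 :+ con 2 :* j)) refl g i ⟩
    3 * suc g + (8 + 2 * i)               ≤⟨ +-monoˡ-≤ (8 + 2 * i) (*-monoʳ-≤ 3 g<τ) ⟩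
    3 * τ + (8 + 2 * i)                   ∎))

-- Rerouting a Hamilton path in a graph without Hamilton cycle

module HamiltonPath {n : ℕ} (n≥3 : n ≥ 3) (G : Graph (Fin n)) (¬Ham : ¬ Hamiltonian G)
  (p : ℕ → Fin n) (N : ℕ) (spanning : ∀ {S} → Seg p 0 N S → S ↭ allFin n)
  (step : ∀ {k} → k < N → Adj G (p k) (p (suc k))) where

  x y : Fin n
  x = p 0
  y = p N

  _∼_ : Fin n → Fin n → Set
  _∼_ = Adj G

  ∼-sym : ∀ {u v} → u ∼ v → v ∼ u
  ∼-sym = Adj-sym G

  X Y Gap W : Pred ℕ 0ℓ
  X i   = i < N × x ∼ p (suc i)
  Y i   = i < N × y ∼ p i
  Gap i = i < N × ¬ X i × ¬ Y i
  -- W i concerns the vertex p (suc i): its two neighbours on the path are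
  -- joined to y and x, so that a cycle through all other vertices bypasses it.
  W i   = Y i × X (suc i)

  record Stretch (i j : ℕ) : Set where
    field
      vertices : List (Fin n)
      seg      : Seg p i j vertices
      route    : Route G (p i) (p j) vertices
  open Stretch using (vertices; seg; route)

  stretch : ∀ {i j} → i ≤ j → j ≤ N → Stretch i j
  stretch i≤j j≤N with S , s ← segment p (≤⇒≤′ i≤j) = record
    { vertices = S
    ; seg      = s
    ; route    = S , Seg⇒Path p (λ k<j → step (<-≤-trans k<j j≤N)) s , ↭-refl
    }

  point : ∀ i → Route G (p i) (p i) (p i ∷ [])
  point i = _ , end (p i) , ↭-refl

  -- `S` lists the blocks in path order and `T` in the order of the tour. As `spanning` accepts any
  -- decomposition into blocks, only a permutation of blocks remains to be checked, a task for the
  -- commutative monoid solver.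
  no-cycle : ∀ {S T u v} → Seg p 0 N S → T ↭ S → Route G u v T → ¬ v ∼ u
  no-cycle s τ r e = ¬Ham (closed-route⇒Hamiltonian G n≥3 (↭-trans τ (spanning s)) r e)

  open import Algebra.Solver.CommutativeMonoid (++-commutativeMonoid {A = Fin n})
    using (solve; _⊜_; _⊕_)

  infixr 5 _+++_
  _+++_ : ∀ {i j k S T} → Seg p i j S → Seg p (suc j) k T → Seg p i k (S ++ T)
  _+++_ = Seg-++ p

  reversed : ∀ {u v S} → Route G u v S → Route G v u S
  reversed = rev G

  infixr 5 _⟪_⟫_
  _⟪_⟫_ : ∀ {u v w t S T} → Route G u v S → v ∼ w → Route G w t T → Route G u t (S ++ T)
  _⟪_⟫_ = _⟨_⟩_ G

  -- Otherwise p_i ... p_0 p_{i+1} ... p_N closes up to a Hamilton cycle.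
  X-Y-disjoint : ∀ {i} → X i → ¬ Y i
  X-Y-disjoint {i} (i<N , x∼) (_ , y∼) =
    no-cycle (seg A +++ seg B) ↭-refl (reversed (route A) ⟪ x∼ ⟫ route B) y∼
    where
    A = stretch {0} {i} z≤n (<⇒≤ i<N)
    B = stretch i<N ≤-refl

  -- Let w = p_{i+1}, so that the path is A B w D. With ⁻ for reversal, the excluded tours are w A⁻
  -- B D⁻, w A⁻ D B and w A⁻ D B⁻; they use y ∼ p_i, x ∼ p_{i+2} or both.
  module Left {i r} (r<i : r < i) (w : W i) where
    i<N   = proj₁ (proj₁ w)
    1+i<N = proj₁ (proj₂ w)
    y∼ = proj₂ (proj₁ w)
    x∼ = proj₂ (proj₂ w)
    r<N = <-trans r<i i<N
    A = stretch {0} {r} z≤n (<⇒≤ r<N)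
    B = stretch r<i (<⇒≤ i<N)
    D = stretch 1+i<N ≤-refl
    path = seg A +++ seg B +++ single (suc i) +++ seg D

    noX : p (suc i) ∼ p r → ¬ x ∼ p (suc r)
    noX e e′ = no-cycle path
      (solve 4 (λ a b w d → (w ⊕ a ⊕ b ⊕ d) ⊜ (a ⊕ b ⊕ w ⊕ d)) ↭-refl
        (vertices A) (vertices B) (p (suc i) ∷ []) (vertices D))
      (point (suc i) ⟪ e ⟫ reversed (route A) ⟪ e′ ⟫ route B ⟪ ∼-sym y∼ ⟫ reversed (route D))
      (∼-sym (step 1+i<N))

    noY : p (suc i) ∼ p r → ¬ y ∼ p (suc r)
    noY e e′ = no-cycle path
      (solve 4 (λ a b w d → (w ⊕ a ⊕ d ⊕ b) ⊜ (a ⊕ b ⊕ w ⊕ d)) ↭-refl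
        (vertices A) (vertices B) (p (suc i) ∷ []) (vertices D))
      (point (suc i) ⟪ e ⟫ reversed (route A) ⟪ x∼ ⟫ route D ⟪ e′ ⟫ route B) (step i<N)

    noConsecutive : p (suc i) ∼ p r → ¬ p (suc i) ∼ p (suc r)
    noConsecutive e e′ = no-cycle path
      (solve 4 (λ a b w d → (w ⊕ a ⊕ d ⊕ b) ⊜ (a ⊕ b ⊕ w ⊕ d)) ↭-refl
        (vertices A) (vertices B) (p (suc i) ∷ []) (vertices D))
      (point (suc i) ⟪ e ⟫ reversed (route A) ⟪ x∼ ⟫ route D ⟪ y∼ ⟫ reversed (route B)) (∼-sym e′)

  -- The mirror image of `Left`: the path is A w B D, and the excluded tours are w D A⁻ B⁻, w D B⁻ A
  -- and w D A⁻ B.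
  module Right {i r} (i<r : i < r) (r<N : suc r < N) (w : W i) where
    i<N   = proj₁ (proj₁ w)
    1+i<N = proj₁ (proj₂ w)
    y∼ = proj₂ (proj₁ w)
    x∼ = proj₂ (proj₂ w)
    A = stretch {0} {i} z≤n (<⇒≤ i<N)
    B = stretch (s≤s i<r) (<⇒≤ r<N)
    D = stretch r<N ≤-refl
    path = seg A +++ single (suc i) +++ seg B +++ seg D

    noX : p (suc i) ∼ p (2 + r) → ¬ x ∼ p (suc r)
    noX e e′ = no-cycle path
      (solve 4 (λ a w b d → (w ⊕ d ⊕ a ⊕ b) ⊜ (a ⊕ w ⊕ b ⊕ d)) ↭-refl
        (vertices A) (p (suc i) ∷ []) (vertices B) (vertices D))
      (point (suc i) ⟪ e ⟫ route D ⟪ y∼ ⟫ reversed (route A) ⟪ e′ ⟫ reversed (route B))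
      (∼-sym (step 1+i<N))

    noY : p (suc i) ∼ p (2 + r) → ¬ y ∼ p (suc r)
    noY e e′ = no-cycle path
      (solve 4 (λ a w b d → (w ⊕ d ⊕ b ⊕ a) ⊜ (a ⊕ w ⊕ b ⊕ d)) ↭-refl
        (vertices A) (p (suc i) ∷ []) (vertices B) (vertices D))
      (point (suc i) ⟪ e ⟫ route D ⟪ e′ ⟫ reversed (route B) ⟪ ∼-sym x∼ ⟫ route A) (step i<N)

    noConsecutive : p (suc i) ∼ p (2 + r) → ¬ p (suc i) ∼ p (suc r)
    noConsecutive e e′ = no-cycle path
      (solve 4 (λ a w b d → (w ⊕ d ⊕ a ⊕ b) ⊜ (a ⊕ w ⊕ b ⊕ d)) ↭-refl
        (vertices A) (p (suc i) ∷ []) (vertices B) (vertices D))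
      (point (suc i) ⟪ e ⟫ route D ⟪ y∼ ⟫ reversed (route A) ⟪ x∼ ⟫ route B) (∼-sym e′)

  -- The adjacencies of the bypassed vertex p (suc i) to its left and right.  Both
  -- are indexed by the position r such that p (suc r) is next to the neighbour
  -- on the side of p (suc i).
  L R : ℕ → Pred ℕ 0ℓ
  L i r = r ≤ i × W i × p (suc i) ∼ p r
  R i r = i ≤ r × suc r < N × W i × p (suc i) ∼ p (2 + r)

  -- For `suc r < N` this concerns the single vertex `p (suc r)`, joined to neither `x` nor `y`: the
  -- index of `X` lags one behind the vertex, that of `Y` does not.
  Free : Pred ℕ 0ℓ
  Free r = ¬ X r × ¬ Y (suc r)

  -- Positions i and i + 1 already carry `Y` and `X`, which shuts out `X` at i and `Y` at i + 1.
  W⇒Free : ∀ {i} → W i → Free i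
  W⇒Free (Yi , Xi) = (λ X′ → X-Y-disjoint X′ Yi) , X-Y-disjoint Xi

  L⇒Free : ∀ {i r} → L i r → Free r
  L⇒Free (r≤i , w , e) with m≤n⇒m<n∨m≡n r≤i
  ... | inj₁ r<i  = (λ X′ → Left.noX r<i w e (proj₂ X′)) , (λ Y′ → Left.noY r<i w e (proj₂ Y′))
  -- The step from the neighbour arrives at the bypassed vertex itself.
  ... | inj₂ refl = W⇒Free w

  R⇒Free : ∀ {i r} → R i r → Free r
  R⇒Free (i≤r , r<N , w , e) with m≤n⇒m<n∨m≡n i≤r
  ... | inj₁ i<r  =
    (λ X′ → Right.noX i<r r<N w e (proj₂ X′)) , (λ Y′ → Right.noY i<r r<N w e (proj₂ Y′))
  ... | inj₂ refl = W⇒Free w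

  -- Such an edge would make p_l, one step from p_{l+1} towards p_{i+1}, a free vertex, but `W l`
  -- joins it to `y`.
  W-independent-< : ∀ {i l} → i < l → W i → W l → ¬ p (suc i) ∼ p (suc l)
  W-independent-< {l = suc l} (s≤s i≤l) Wi (Yl , Xl) e =
    proj₂ (R⇒Free (i≤l , proj₁ Yl , Wi , e)) Yl

  W-independent : ∀ {i l} → W i → W l → ¬ p (suc i) ∼ p (suc l)
  W-independent {i} {l} Wi Wl e with <-cmp i l
  ... | tri< i<l _ _  = W-independent-< i<l Wi Wl e
  ... | tri≈ _ refl _ = Adj-irrefl G e
  ... | tri> _ _ l<i  = W-independent-< l<i Wl Wi (∼-sym e)

  -- With the path cut as A w B C w′ D, where w = p_{i+1} and w′ = p_{l+1}, the crossing edges would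
  -- permit the tour w C D⁻ w′ B⁻ A.
  no-crossing-< : ∀ {i r l} → i < r → suc r < l → W i → W l →
                  p (suc i) ∼ p (2 + r) → ¬ p (suc l) ∼ p (suc r)
  no-crossing-< {i} {r} {l} i<r r<l ((i<N , y∼i) , (_ , x∼i)) ((l<N , y∼l) , (1+l<N , x∼l)) e e′ =
    no-cycle (seg A +++ single (suc i) +++ seg B +++ seg C +++ single (suc l) +++ seg D)
      (solve 6 (λ a w b c w′ d → (w ⊕ c ⊕ d ⊕ w′ ⊕ b ⊕ a) ⊜ (a ⊕ w ⊕ b ⊕ c ⊕ w′ ⊕ d)) ↭-refl
        (vertices A) (p (suc i) ∷ []) (vertices B) (vertices C) (p (suc l) ∷ []) (vertices D))
      (point (suc i) ⟪ e ⟫ route C ⟪ ∼-sym y∼l ⟫ reversed (route D) ⟪ ∼-sym (step 1+l<N) ⟫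
        point (suc l) ⟪ e′ ⟫ reversed (route B) ⟪ ∼-sym x∼i ⟫ route A)
      (step i<N)
    where
    r<N = <-trans r<l l<N
    A = stretch {0} {i} z≤n (<⇒≤ i<N)
    B = stretch (s≤s i<r) (<⇒≤ r<N)
    C = stretch r<l (<⇒≤ l<N)
    D = stretch 1+l<N ≤-refl

  no-crossing : ∀ {i r l} → R i r → ¬ L l (suc r)
  no-crossing (i≤r , _ , Wi , e) (r<l , Wl , e′)
    with m≤n⇒m<n∨m≡n i≤r | m≤n⇒m<n∨m≡n r<l
  -- In the two boundary cases one of the crossing edges joins two bypassed vertices.
  ... | inj₂ refl | _         = W-independent Wl Wi e′
  ... | inj₁ _    | inj₂ refl = W-independent Wi Wl e
  ... | inj₁ i<r  | inj₁ 1+r<l = no-crossing-< i<r 1+r<l Wi Wl e e′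

  -- Counting along the Hamilton path

  X? : Decidable X
  X? i = i <? N ×-dec adj? G x (p (suc i))

  Y? : Decidable Y
  Y? i = i <? N ×-dec adj? G y (p i)

  Gap? : Decidable Gap
  Gap? i = i <? N ×-dec ¬? (X? i) ×-dec ¬? (Y? i)

  W? : Decidable W
  W? i = Y? i ×-dec X? (suc i)

  L? : ∀ i → Decidable (L i)
  L? i r = r ≤? i ×-dec W? i ×-dec adj? G (p (suc i)) (p r)

  R? : ∀ i → Decidable (R i)
  R? i r = i ≤? r ×-dec suc r <? N ×-dec W? i ×-dec adj? G (p (suc i)) (p (2 + r))

  K g : ℕ
  K = # N W?
  g = # N Gap?

  W⇒< : ∀ {i} → W i → i < N
  W⇒< w = proj₁ (proj₁ w)

  L⇒< : ∀ {i r} → L i r → suc r < N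
  L⇒< (r≤i , w , _) = ≤-<-trans (s≤s r≤i) (proj₁ (proj₂ w))

  R⇒< : ∀ {i r} → R i r → suc r < N
  R⇒< (_ , r<N , _) = r<N

  -- `R` is indexed two places below the neighbour, hence the double `↑`. Between the two sides only
  -- k = i + 1 is left, which irreflexivity excludes.
  classify-neighbour : ∀ {i k} → W i → k ≤ N → p (suc i) ∼ p k → ↑ (↑ (R i)) k ⊎ L i k
  classify-neighbour {i} {k} w k≤N e with k ≤? i
  ... | yes k≤i = inj₂ (k≤i , w , e)
  ... | no  k≰i with m≤n⇒m<n∨m≡n (≰⇒> k≰i)
  ...   | inj₂ refl              = contradiction e (Adj-irrefl G)
  classify-neighbour {k = suc (suc r)} w k≤N e | no _ | inj₁ (s≤s (s≤s i≤r)) =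
    inj₁ (i≤r , k≤N , w , e)

  -- Without `X` at r, that position is a gap unless `Y` holds there; without `Y` at r + 1, that one
  -- is a gap unless `X` holds. If neither is a gap, both halves of `W r` are present.
  Free⇒W⊎Gap : ∀ {r} → suc r < N → Free r → W r ⊎ (Gap r ⊎ Gap (suc r))
  Free⇒W⊎Gap {r} r<N (¬X , ¬Y) with Y? r | X? (suc r)
  ... | yes Yr | yes X+ = inj₁ (Yr , X+)
  ... | yes _  | no ¬X+ = inj₂ (inj₂ (r<N , ¬X+ , ¬Y))
  ... | no ¬Yr | _      = inj₂ (inj₁ (<⇒≤ r<N , ¬X , ¬Yr))

  x≢p : ∀ {i} → i < N → x ≢ p (suc i)
  x≢p i<N with _ , s ← segment p (≤⇒≤′ (≤-<-trans z≤n i<N))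
    with x∉ ∷ _ ← Unique-resp-↭ (↭-sym (spanning (0 ◂ s))) (allFin⁺ n) =
    All.lookup x∉ (Seg-∈ p s (s≤s z≤n) i<N)

  n≡1+N : n ≡ suc N
  n≡1+N with S , s ← segment p (≤⇒≤′ (z≤n {N})) =
    trans (sym (length-tabulate {n = n} id))
      (trans (sym (↭-length (spanning s))) (trans (sym (+-identityʳ _)) (Seg-length p s)))

  ∣_∣≡# : (T : Subset n) → ∣ T ∣ ≡ # (suc N) (λ k → p k ∈? T)
  ∣ T ∣≡# with _ , s ← segment p (≤⇒≤′ (z≤n {N})) = ∣∣≡# p s (spanning s) T

  nbhd : Fin n → Subset n
  nbhd = Defs.N G

  deg≤ : ∀ u {P : Pred ℕ 0ℓ} (P? : Decidable P) → (∀ k → k ≤ N → u ∼ p k → P k) →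
         deg G u ≤ # (suc N) P?
  deg≤ u P? f rewrite ∣ nbhd u ∣≡# = #-mono (suc N) (λ k → p k ∈? nbhd u) P?
    λ k k≤N u∼ → f k (s≤s⁻¹ k≤N) (∈-tabulate⁻ (adj? G u) u∼)

  deg-x≤ : deg G x ≤ # N X?
  deg-x≤ = deg≤ x (↑? X?) λ where
    zero    _   x∼x → Adj-irrefl G x∼x
    (suc i) i<N x∼  → i<N , x∼

  deg-y≤ : deg G y ≤ # N Y?
  deg-y≤ = ≤-trans (deg≤ y Y? y∼⇒Y) (#-bounded (suc N) N Y? (λ _ → proj₁))
    where
    y∼⇒Y : ∀ k → k ≤ N → y ∼ p k → Y k
    y∼⇒Y k k≤N y∼ with m≤n⇒m<n∨m≡n k≤N
    ... | inj₁ k<N  = k<N , y∼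
    ... | inj₂ refl = contradiction y∼ (Adj-irrefl G)

  deg+deg+g≤N : (deg G x + deg G y) + g ≤ N
  deg+deg+g≤N = begin
    (deg G x + deg G y) + g         ≤⟨ +-monoˡ-≤ g (+-mono-≤ deg-x≤ deg-y≤) ⟩
    (# N X? + # N Y?) + g           ≤⟨ +-monoˡ-≤ g (#-disjoint N X? Y? X⊎Y?
                                         (λ _ → X-Y-disjoint) (λ _ → inj₁) (λ _ → inj₂)) ⟩
    # N X⊎Y? + g                    ≤⟨ #-disjoint N X⊎Y? Gap? (λ i → X⊎Y? i ⊎-dec Gap? i)
                                         (λ _ xy (_ , ¬X , ¬Y) → [ ¬X , ¬Y ]′ xy)
                                         (λ _ → inj₁) (λ _ → inj₂) ⟩
    # N (λ i → X⊎Y? i ⊎-dec Gap? i) ≤⟨ #≤ N _ ⟩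
    N                               ∎
    where
    open ≤-Reasoning
    X⊎Y? : Decidable (λ i → X i ⊎ Y i)
    X⊎Y? i = X? i ⊎-dec Y? i

  Bypassed Attached : Pred (Fin n) 0ℓ
  Bypassed v = ∃ λ i → i < N × W i × p (suc i) ≡ v
  Attached v = ∃ λ i → i < N × W i × p (suc i) ∼ v

  Bypassed? : Decidable Bypassed
  Bypassed? v = anyUpTo? (λ i → W? i ×-dec p (suc i) Fin.≟ v) N

  Attached? : Decidable Attached
  Attached? v = anyUpTo? (λ i → W? i ×-dec adj? G (p (suc i)) v) N

  I S : Subset n
  I = tabulate (does ∘ Bypassed?)
  S = tabulate (does ∘ Attached?)

  K≤∣I∣ : K ≤ ∣ I ∣
  K≤∣I∣ rewrite ∣ I ∣≡# = #-mono (suc N) (↑? W?) (λ k → p k ∈? I) λ where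
    (suc i) _ w → ∈-tabulate⁺ Bypassed? (i , W⇒< w , w , refl)

  -- A left neighbour p_r is counted at r, a right neighbour p_{r+2} at r + 1; by `no-crossing` no
  -- position is used from both sides. A used position r is itself a gap, or is charged to `W` or a
  -- gap at r - 1 (right), or to `W` at r or a gap at r + 1 (left). The gap at r serves both sides
  -- at once, whence 3g and not 4g.
  ∣S∣≤ : ∣ S ∣ ≤ g + ((K + g) + (K + g))
  ∣S∣≤ = begin
    ∣ S ∣                                  ≡⟨ ∣ S ∣≡# ⟩
    # (suc N) (λ k → p k ∈? S)
      ≤⟨ #-⊎ (suc N) (λ k → p k ∈? S) (↑? (↑? R⋆?)) L⋆? (λ k k≤N → S⇒ k (s≤s⁻¹ k≤N)) ⟩
    # N (↑? R⋆?) + # (suc N) L⋆?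
      ≤⟨ +-monoʳ-≤ (# N (↑? R⋆?)) (#-bounded (suc N) N L⋆? L⋆<) ⟩
    # N (↑? R⋆?) + # N L⋆?
      ≤⟨ #-disjoint N (↑? R⋆?) L⋆? T? R⋆-L⋆-disjoint (λ _ → inj₁) (λ _ → inj₂) ⟩
    # N T?                                 ≤⟨ #-⊎ N T? Gap? B? (λ r _ → T⇒ r) ⟩
    g + # N B?                             ≤⟨ +-monoʳ-≤ g (#-⊎ N B? (↑? C?) C′? λ _ _ b → b) ⟩
    g + (# N (↑? C?) + # N C′?)            ≤⟨ +-monoʳ-≤ g (+-monoˡ-≤ (# N C′?) (#-↑ N C?)) ⟩
    g + (# N C? + # N C′?)
      ≤⟨ +-monoʳ-≤ g (+-mono-≤ (#-⊎ N C? W? Gap? λ _ _ c → c)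
                                (#-⊎ N C′? W? (Gap? ∘ suc) λ _ _ c → c)) ⟩
    g + ((K + g) + (K + # N (Gap? ∘ suc)))
      ≤⟨ +-monoʳ-≤ g (+-monoʳ-≤ (K + g) (+-monoʳ-≤ K (#-shift N Gap? (λ _ → proj₁)))) ⟩
    g + ((K + g) + (K + g))                ∎
    where
    open ≤-Reasoning
    L⋆ R⋆ C C′ B T : Pred ℕ 0ℓ
    L⋆ r = ∃ λ i → i < N × L i r
    R⋆ r = ∃ λ i → i < N × R i r
    T r  = ↑ R⋆ r ⊎ L⋆ r
    C r  = W r ⊎ Gap r
    C′ r = W r ⊎ Gap (suc r)
    B r  = ↑ C r ⊎ C′ r
    L⋆? : Decidable L⋆
    L⋆? r = anyUpTo? (λ i → L? i r) N
    R⋆? : Decidable R⋆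
    R⋆? r = anyUpTo? (λ i → R? i r) N
    T? : Decidable T
    T? r = ↑? R⋆? r ⊎-dec L⋆? r
    C? : Decidable C
    C? r = W? r ⊎-dec Gap? r
    C′? : Decidable C′
    C′? r = W? r ⊎-dec Gap? (suc r)
    B? : Decidable B
    B? r = ↑? C? r ⊎-dec C′? r
    S⇒ : ∀ k → k ≤ N → p k ∈ S → ↑ (↑ R⋆) k ⊎ L⋆ k
    S⇒ k k≤N k∈ with i , i<N , w , e ← ∈-tabulate⁻ Attached? k∈
      with k | classify-neighbour w k≤N e
    ... | suc (suc r) | inj₁ Rr = inj₁ (i , i<N , Rr)
    ... | _           | inj₂ Lk = inj₂ (i , i<N , Lk)
    L⋆< : ∀ r → L⋆ r → r < N
    L⋆< r (_ , _ , l) = <⇒≤ (L⇒< l)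
    R⋆-L⋆-disjoint : ∀ r → ↑ R⋆ r → ¬ L⋆ r
    R⋆-L⋆-disjoint (suc r) (_ , _ , Rr) (_ , _ , Lr) = no-crossing Rr Lr
    T⇒ : ∀ r → T r → Gap r ⊎ B r
    T⇒ r (inj₂ (_ , _ , l)) with Free⇒W⊎Gap (L⇒< l) (L⇒Free l)
    ... | inj₁ w        = inj₂ (inj₂ (inj₁ w))
    ... | inj₂ (inj₁ h) = inj₁ h
    ... | inj₂ (inj₂ h) = inj₂ (inj₂ (inj₂ h))
    T⇒ (suc r) (inj₁ (_ , _ , r′)) with Free⇒W⊎Gap (R⇒< r′) (R⇒Free r′)
    ... | inj₁ w        = inj₂ (inj₁ (inj₁ w))
    ... | inj₂ (inj₁ h) = inj₂ (inj₁ (inj₂ h))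
    ... | inj₂ (inj₂ h) = inj₁ h

  -- The degree of a bypassed vertex, and the use of toughness

  module _ {s} (w : W s) where

    z : Fin n
    z = p (suc s)

    -- The neighbours of z are never consecutive, so that each gap accounts for at
    -- most one of the free vertices they give rise to.
    deg-z≤ : deg G z ≤ 1 + (K + g)
    deg-z≤ = begin
      deg G z                            ≤⟨ deg≤ z RL? (λ _ → classify-neighbour w) ⟩
      # (suc N) RL?
        ≤⟨ #-⊎ (suc N) RL? (↑? (↑? (R? s))) (L? s) (λ _ _ rl → rl) ⟩
      # N (↑? (R? s)) + # (suc N) (L? s)
        ≤⟨ +-mono-≤ (#-↑ N (R? s)) (#-bounded (suc N) N (L? s) λ _ l → <⇒≤ (L⇒< l)) ⟩
      # N (R? s) + # N (L? s)
        ≤⟨ +-mono-≤ (#-⊎ N (R? s) (s ≟_) UR? (λ r _ → split))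
                     (#-⊎ N (L? s) (s ≟_) UL? (λ r _ → split)) ⟩
      (e + # N UR?) + (e + # N UL?)
        ≡⟨ interchange +-commutativeSemigroup e (# N UR?) e (# N UL?) ⟩
      (e + e) + (# N UR? + # N UL?)
        -- Position `s` may occur once on each side, for the path neighbours p_s and p_{s+2} of `z`.
        -- One occurrence costs the constant 1; the other is covered by `W s`.
        ≤⟨ +-mono-≤ (+-monoˡ-≤ e (#-singleton N s))
                     (#-disjoint N UR? UL? U? UR-UL-disjoint (λ _ → inj₁) (λ _ → inj₂)) ⟩
      (1 + e) + # N U?                   ≡⟨⟩
      1 + (e + # N U?)
        ≤⟨ s≤s (#-disjoint N (s ≟_) U? V? s∉U (λ _ → inj₁) (λ _ → inj₂)) ⟩
      1 + # N V?                         ≤⟨ s≤s (#-⊎ N V? W? H? (λ _ _ → V⇒)) ⟩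
      1 + (K + # N H?)
        ≤⟨ s≤s (+-monoʳ-≤ K (#-⊎ N H? H₁? (H₂? ∘ suc) (λ _ _ h → h))) ⟩
      1 + (K + (# N H₁? + # N (H₂? ∘ suc)))
        ≤⟨ s≤s (+-monoʳ-≤ K (+-monoʳ-≤ (# N H₁?) (#-shift N H₂? (λ _ h → proj₁ (proj₁ h))))) ⟩
      1 + (K + (# N H₁? + # N H₂?))
        ≤⟨ s≤s (+-monoʳ-≤ K (#-disjoint N H₁? H₂? Gap? H-disjoint (λ _ → proj₁) (λ _ → proj₁))) ⟩
      1 + (K + g)                        ∎
      where
      open ≤-Reasoning
      e = # N (s ≟_)
      UR UL U V H₁ H₂ H : Pred ℕ 0ℓ
      UR r = s ≢ r × R s r
      UL r = s ≢ r × L s r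
      U r  = UR r ⊎ UL r
      V r  = s ≡ r ⊎ U r
      -- A gap at r can be charged from r or from r - 1; `U-sparse` rules out both at once.
      H₁ r = Gap r × U r
      H₂ r = Gap r × ↑ U r
      H r  = H₁ r ⊎ H₂ (suc r)
      RL? : Decidable (λ k → ↑ (↑ (R s)) k ⊎ L s k)
      RL? k = ↑? (↑? (R? s)) k ⊎-dec L? s k
      UR? : Decidable UR
      UR? r = ¬? (s ≟ r) ×-dec R? s r
      UL? : Decidable UL
      UL? r = ¬? (s ≟ r) ×-dec L? s r
      U? : Decidable U
      U? r = UR? r ⊎-dec UL? r
      V? : Decidable V
      V? r = s ≟ r ⊎-dec U? r
      H₁? : Decidable H₁
      H₁? r = Gap? r ×-dec U? r
      H₂? : Decidable H₂
      H₂? r = Gap? r ×-dec ↑? U? r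
      H? : Decidable H
      H? r = H₁? r ⊎-dec H₂? (suc r)
      split : ∀ {r} {A : Set} → A → s ≡ r ⊎ (s ≢ r × A)
      split {r} a with s ≟ r
      ... | yes s≡r = inj₁ s≡r
      ... | no  s≢r = inj₂ (s≢r , a)
      s∉U : ∀ r → s ≡ r → ¬ U r
      s∉U r s≡r = [ (λ u → proj₁ u s≡r) , (λ u → proj₁ u s≡r) ]′
      UR⇒< : ∀ {r} → UR r → s < r
      UR⇒< (s≢r , s≤r , _) = ≤∧≢⇒< s≤r s≢r
      UL⇒> : ∀ {r} → UL r → r < s
      UL⇒> (s≢r , r≤s , _) = ≤∧≢⇒< r≤s (s≢r ∘ sym)
      UR-UL-disjoint : ∀ r → UR r → ¬ UL r
      UR-UL-disjoint r ur ul = <-asym (UR⇒< ur) (UL⇒> ul)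
      U-sparse : ∀ {r} → U r → ¬ U (suc r)
      U-sparse (inj₁ (_ , s≤r , _ , _ , e₁)) (inj₁ (_ , _ , r<N , _ , e₂)) =
        Right.noConsecutive (s≤s s≤r) r<N w e₂ e₁
      U-sparse (inj₂ (_ , _ , _ , e₁)) (inj₂ (_ , r<s , _ , e₂)) =
        Left.noConsecutive r<s w e₁ e₂
      U-sparse (inj₁ ur) (inj₂ ul) = <-asym (UR⇒< ur) (<⇒≤ (UL⇒> ul))
      U-sparse (inj₂ ul) (inj₁ ur) = <⇒≱ (UL⇒> ul) (s≤s⁻¹ (UR⇒< ur))
      H-disjoint : ∀ r → H₁ r → ¬ H₂ r
      H-disjoint (suc r) (_ , u) (_ , u′) = U-sparse u′ u
      V⇒ : ∀ {r} → V r → W r ⊎ H r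
      V⇒ (inj₁ refl) = inj₁ w
      V⇒ (inj₂ u) with ([ (λ v → Free⇒W⊎Gap (R⇒< (proj₂ v)) (R⇒Free (proj₂ v)))
                        , (λ v → Free⇒W⊎Gap (L⇒< (proj₂ v)) (L⇒Free (proj₂ v))) ]′ u)
      ... | inj₁ w′       = inj₁ w′
      ... | inj₂ (inj₁ h) = inj₂ (inj₁ (h , u))
      ... | inj₂ (inj₂ h) = inj₂ (inj₂ (h , u))

    module _ {τ} (tough : ToughAt G τ) where

      -- Hence `x` survives the deletion of any neighbourhood of bypassed vertices and supplies the
      -- additional component.
      x≁W : ∀ {i} → W i → ¬ p (suc i) ∼ x
      x≁W (Yi , _) e = X-Y-disjoint (proj₁ Yi , ∼-sym e) Yi

      2τ≤deg-z : τ * 2 ≤ deg G z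
      2τ≤deg-z = subst (λ c → τ * suc c ≤ deg G z) (∣⁅x⁆∣≡1 z)
        (isolated-bound G {τ} tough ⁅ z ⁆ (nbhd z) (z , x∈⁅x⁆ z)
          (λ v∈ v∈N → Adj-irrefl G (subst (z ∼_) (x∈⁅y⁆⇒x≡y z v∈) (∈-tabulate⁻ (adj? G z) v∈N)))
          (λ v∈ e → ∈-tabulate⁺ (adj? G z) (subst (_∼ _) (x∈⁅y⁆⇒x≡y z v∈) e))
          x (λ x∈ → x≢p (W⇒< w) (x∈⁅y⁆⇒x≡y z x∈)) (λ x∈N → x≁W w (∈-tabulate⁻ (adj? G z) x∈N)))

      τ[1+K]≤∣S∣ : τ * suc K ≤ ∣ S ∣
      τ[1+K]≤∣S∣ = ≤-trans (*-monoʳ-≤ τ (s≤s K≤∣I∣))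
        (isolated-bound G {τ} tough I S (z , ∈-tabulate⁺ Bypassed? (s , W⇒< w , w , refl))
          (λ i∈I i∈S → independent (∈-tabulate⁻ Bypassed? i∈I) (∈-tabulate⁻ Attached? i∈S))
          (λ i∈I e → ∈-tabulate⁺ Attached? (attach (∈-tabulate⁻ Bypassed? i∈I) e))
          x (λ x∈I → let i , i<N , _ , eq = ∈-tabulate⁻ Bypassed? x∈I in x≢p i<N (sym eq))
          (λ x∈S → let _ , _ , w′ , e = ∈-tabulate⁻ Attached? x∈S in x≁W w′ e))
        where
        independent : ∀ {v} → Bypassed v → ¬ Attached v
        independent (_ , _ , w₁ , refl) (_ , _ , w₂ , e) = W-independent w₂ w₁ e
        attach : ∀ {u v} → Bypassed u → u ∼ v → Attached v
        attach (i , i<N , w′ , refl) e = i , i<N , w′ , e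

      -- If this fails, `deg+deg+g≤N` leaves room for fewer than `τ` gaps, and the two toughness
      -- bounds contradict each other.
      degree-sum< : 4 ≤ τ → deg G x + deg G y + τ < n
      degree-sum< 4≤τ = ≰⇒> λ n≤ → bounds-incompatible 4≤τ (g<τ n≤)
        (≤-trans 2τ≤deg-z deg-z≤) (≤-trans τ[1+K]≤∣S∣ ∣S∣≤)
        where
        g<τ : n ≤ deg G x + deg G y + τ → g < τ
        g<τ n≤ = +-cancelˡ-≤ (deg G x + deg G y) (suc g) τ (begin
          deg G x + deg G y + suc g ≡⟨ +-suc (deg G x + deg G y) g ⟩
          suc (deg G x + deg G y + g) ≤⟨ s≤s deg+deg+g≤N ⟩
          suc N                       ≡⟨ n≡1+N ⟨
          n                           ≤⟨ n≤ ⟩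
          deg G x + deg G y + τ       ∎)
          where open ≤-Reasoning

-- From the cycle and `z` to the Hamilton path

unique∧complete⇒↭allFin : ∀ {n} {xs : List (Fin n)} → Unique xs →
                          (∀ v → v List.∈ xs) → xs ↭ allFin n
unique∧complete⇒↭allFin {n} u c =
  ∼bag⇒↭ (unique∧set⇒bag u (allFin⁺ n) (mk⇔ (λ _ → ∈-allFin _) (λ _ → c _)))

-- The edges from `v` to `b` and from `u` to `a` are the two halves of `W` at the position of `b`,
-- so `z` is a bypassed vertex.
path-degree-sum< : ∀ {n} → n ≥ 3 → (G : Graph (Fin n)) → ¬ Hamiltonian G →
  ∀ {u b z a v S T} → Route G u b S → Adj G b z → Adj G z a → Route G a v T →
  S ++ z ∷ T ↭ allFin n → Adj G u a → Adj G v b →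
  ∀ {τ} → ToughAt G τ → 4 ≤ τ → deg G u + deg G v + τ < n
path-degree-sum< {n} n≥3 G ¬Ham {z = z} (_ , α , σ) bz za (_ , β , σ′) S↭ ua vb {τ} tough 4≤τ =
  subst₂ (λ x y → deg G x + deg G y + τ < n) (at-head π) (at-last π)
    (degree-sum< (Y-s , X-s) tough 4≤τ)
  where
  π = Path-++ (Adj G) α bz (za ∷ β)
  spanning : ∀ {S} → Seg (at π) 0 (steps π) S → S ↭ allFin n
  spanning s = subst (_↭ allFin n) (Seg-unique (at π) (at-Seg π) s)
    (↭-trans (++⁺ σ (prep z σ′)) S↭)
  open HamiltonPath n≥3 G ¬Ham (at π) (steps π) spanning (at-step π) using (X; Y; degree-sum<)
  junction = at-junction α bz za β
  s = proj₁ junction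
  2+s≤ : 2 + s ≤ steps π
  2+s≤ = proj₂ (proj₂ (proj₂ (proj₂ junction)))
  Y-s : Y s
  Y-s = <⇒≤ 2+s≤ , subst₂ (Adj G) (sym (at-last π)) (sym (proj₁ (proj₂ junction))) vb
  X-s : X (suc s)
  X-s = 2+s≤ , subst₂ (Adj G) (sym (at-head π)) (sym (proj₁ (proj₂ (proj₂ (proj₂ junction))))) ua

module _ {n : ℕ} (n≥3 : n ≥ 3) (G : Graph (Fin n)) (¬Ham : ¬ Hamiltonian G)
         (z : Fin n) (C : Cycle (G - z)) (C-Ham : IsHamilton C) where

  open import Algebra.Solver.CommutativeMonoid (++-commutativeMonoid {A = Fin n})
    using (_⊜_; _⊕_) renaming (solve to solve↭)

  private
    m M : ℕ
    m = 2 + excess C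
    M = suc m

  -- Indices are read modulo `M`, so `c (suc j)` is the successor also at the last position, and
  -- `c (suc (toℕ i))` agrees by computation with the vertex at `next i`.
  c : ℕ → Fin n
  c k = proj₁ (vertex C (k mod M))

  toℕ-mod : ∀ (i : Fin M) → toℕ i mod M ≡ i
  toℕ-mod i = toℕ-injective (trans (toℕ-fromℕ< _) (m<n⇒m%n≡m (toℕ<n i)))

  c-toℕ : ∀ i → c (toℕ i) ≡ proj₁ (vertex C i)
  c-toℕ i = cong (proj₁ ∘ vertex C) (toℕ-mod i)

  c-step : ∀ {k} → k < M → Adj G (c k) (c (suc k))
  c-step k<M = subst (λ k → Adj G (c k) (c (suc k))) (toℕ-fromℕ< k<M)
    (subst (λ v → Adj G v (c (suc (toℕ i)))) (sym (c-toℕ i)) (adjacent C i))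
    where i = fromℕ< k<M

  c-closed : c M ≡ c 0
  c-closed = cong (proj₁ ∘ vertex C) (toℕ-injective (trans (toℕ-fromℕ< _) (n%n≡0 M)))

  z≢c : ∀ k → z ≢ c k
  z≢c k z≡ = x∈∁p⇒x∉p (proj₂ (vertex C (k mod M))) (subst (_∈ ⁅ z ⁆) z≡ (x∈⁅x⁆ z))

  c-injective : ∀ {k l} → k < M → l < M → c k ≡ c l → k ≡ l
  c-injective k<M l<M eq =
    trans (sym (toℕ-c k<M)) (trans (cong toℕ (injective C (Σ-≡ eq))) (toℕ-c l<M))
    where
    toℕ-c : ∀ {k} → k < M → toℕ (k mod M) ≡ k
    toℕ-c k<M = trans (toℕ-fromℕ< _) (m<n⇒m%n≡m k<M)
    Σ-≡ : ∀ {u v : Σ (Fin n) (_∈ ∁ ⁅ z ⁆)} → proj₁ u ≡ proj₁ v → u ≡ v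
    Σ-≡ {u , u∈} {_ , v∈} refl = cong (u ,_) ([]=-irrelevant u∈ v∈)

  z∷C-spanning : ∀ {S} → Seg c 0 m S → z ∷ S ↭ allFin n
  z∷C-spanning {S} s = unique∧complete⇒↭allFin
    (Seg-All c s (λ {k} _ _ → z≢c k) ∷
     Seg-Unique c s (λ k<l l≤m eq → <⇒≢ k<l (c-injective (<-trans k<l (s≤s l≤m)) (s≤s l≤m) eq)))
    complete
    where
    complete : ∀ v → v List.∈ z ∷ S
    complete v with v Fin.≟ z
    ... | yes v≡z = here v≡z
    ... | no  v≢z with i , eq ← C-Ham (v , x∉p⇒x∈∁p (v≢z ∘ x∈⁅y⁆⇒x≡y z)) =
      there (subst (List._∈ S) (trans (c-toℕ i) (cong proj₁ eq))
        (Seg-∈ c s z≤n (s≤s⁻¹ (toℕ<n i))))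

  -- The path is c (suc i) … c j, z, c i … c 0, c m … c (suc j), where the last
  -- part is empty when j ≡ m.
  cycle-degree-sum< : ∀ {i j} → i < j → j < M → Adj G z (c i) → Adj G z (c j) →
    ∀ {τ} → ToughAt G τ → 4 ≤ τ → deg G (c (suc i)) + deg G (c (suc j)) + τ < n
  cycle-degree-sum< {i} {j} i<j j<M zi zj = case m≤n⇒m<n∨m≡n (s≤s⁻¹ j<M) of λ where
      (inj₁ j<m)  → let _ , sD , D = stretch j<m ≤-refl in
        conclude
          (rev G A ⟨ subst (λ v → Adj G v (c m)) c-closed (Adj-sym G (c-step ≤-refl)) ⟩′ rev G D)
          (↭-trans
            (solve↭ 4 (λ a b z d → (b ⊕ z ⊕ a ⊕ d) ⊜ (z ⊕ a ⊕ b ⊕ d)) ↭-refl SA SB (z ∷ []) _)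
            (z∷C-spanning (Seg-++ c sA (Seg-++ c sB sD))))
      (inj₂ refl) → conclude (subst (λ v → Route G (c i) v SA) (sym c-closed) (rev G A))
          (↭-trans (solve↭ 3 (λ a b z → (b ⊕ z ⊕ a) ⊜ (z ⊕ a ⊕ b)) ↭-refl SA SB (z ∷ []))
            (z∷C-spanning (Seg-++ c sA sB)))
    where
    stretch : ∀ {i j} → i ≤ j → j ≤ m → ∃ λ S → Seg c i j S × Route G (c i) (c j) S
    stretch i≤j j≤m with S , s ← segment c (≤⇒≤′ i≤j) =
      S , s , S , Seg⇒Path c (λ k<j → c-step (<-≤-trans k<j (m≤n⇒m≤1+n j≤m))) s , ↭-refl
    infixr 5 _⟨_⟩′_
    _⟨_⟩′_ = _⟨_⟩_ G
    i<M = <-trans i<j j<M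
    prefix = stretch {0} {i} z≤n (s≤s⁻¹ i<M)
    middle = stretch {suc i} {j} i<j (s≤s⁻¹ j<M)
    SA = proj₁ prefix
    sA = proj₁ (proj₂ prefix)
    A  = proj₂ (proj₂ prefix)
    SB = proj₁ middle
    sB = proj₁ (proj₂ middle)
    B  = proj₂ (proj₂ middle)
    conclude : ∀ {T} → Route G (c i) (c (suc j)) T → SB ++ z ∷ T ↭ allFin n →
      ∀ {τ} → ToughAt G τ → 4 ≤ τ → deg G (c (suc i)) + deg G (c (suc j)) + τ < n
    -- The edges required at the two ends of the path are the cycle edges leaving c_i and c_j.
    conclude r σ = path-degree-sum< n≥3 G ¬Ham B (Adj-sym G zj) zi r σ
      (Adj-sym G (c-step i<M)) (Adj-sym G (c-step j<M))

  z∼c : ∀ {i} → proj₁ (vertex C i) ∈ Defs.N G z → Adj G z (c (toℕ i))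
  z∼c {i} i∈ = subst (Adj G z) (sym (c-toℕ i)) (∈-tabulate⁻ (adj? G z) i∈)

  successors-degree-sum< : ∀ {x y} → x ≢ y → x ∈⁺[ C ] Defs.N G z → y ∈⁺[ C ] Defs.N G z →
    ∀ {τ} → ToughAt G τ → 4 ≤ τ → deg G x + deg G y + τ < n
  successors-degree-sum< x≢y (i , i∈ , refl) (j , j∈ , refl) {τ} tough 4≤τ
    with <-cmp (toℕ i) (toℕ j)
  ... | tri< i<j _ _ = cycle-degree-sum< i<j (toℕ<n j) (z∼c i∈) (z∼c j∈) tough 4≤τ
  ... | tri≈ _ i≡j _ = contradiction (cong (c ∘ suc) i≡j) x≢y
  ... | tri> _ _ j<i = subst (λ d → d + τ < n) (+-comm (deg G (c (suc (toℕ j)))) _)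
    (cycle-degree-sum< j<i (toℕ<n i) (z∼c j∈) (z∼c i∈) tough 4≤τ)

-- Passing between natural and rational toughness

ℕ→ℚ-+ : ∀ a b → ℕ→ℚ (a + b) ≡ ℕ→ℚ a ℚ.+ ℕ→ℚ b
ℕ→ℚ-+ a b = ℚ.toℚᵘ-injective (ℚᵘ.≃-trans
  (*≡* (cong (ℤ._* ℤ.+ 1) (sym (cong₂ ℤ._+_ (ℤ.*-identityʳ (ℤ.+ a)) (ℤ.*-identityʳ (ℤ.+ b))))))
  (ℚᵘ.≃-sym (ℚ.toℚᵘ-homo-+ (ℕ→ℚ a) (ℕ→ℚ b))))

ℕ→ℚ-* : ∀ a b → ℕ→ℚ (a * b) ≡ ℕ→ℚ a ℚ.* ℕ→ℚ b
ℕ→ℚ-* a b = ℚ.toℚᵘ-injective (ℚᵘ.≃-trans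
  (*≡* (cong (ℤ._* ℤ.+ 1) (ℤ.pos-* a b)))
  (ℚᵘ.≃-sym (ℚ.toℚᵘ-homo-* (ℕ→ℚ a) (ℕ→ℚ b))))

ℕ→ℚ-cancel-≤ : ∀ {a b} → ℕ→ℚ a ℚ.≤ ℕ→ℚ b → a ≤ b
ℕ→ℚ-cancel-≤ (*≤* a≤b) =
  ℤ.drop‿+≤+ (subst₂ ℤ._≤_ (ℤ.*-identityʳ _) (ℤ.*-identityʳ _) a≤b)

Tough⇒ToughAt : ∀ {n t} {G : Graph (Fin n)} {τ} → Tough t G → ℕ→ℚ τ ℚ.≤ t → ToughAt G τ
Tough⇒ToughAt {τ = τ} tough τ≤t S c cc c≥2 = ℕ→ℚ-cancel-≤
  (ℚ.≤-trans (ℚ.≤-reflexive (ℕ→ℚ-* τ c))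
    (ℚ.≤-trans (ℚ.*-monoʳ-≤-nonNeg (ℕ→ℚ c) τ≤t) (tough S c cc c≥2)))

theorem6 :
    (t : ℚ) → t ℚ.≥ ℕ→ℚ 4 →
    (n : ℕ) → n ≥ 3 →
    (G : Graph (Fin n)) → Tough t G → ¬ Hamiltonian G →
    (z : Fin n) (C : Cycle (G - z)) → IsHamilton C →
    (x y : Fin n) → x ≢ y →
    x ∈⁺[ C ] N G z → y ∈⁺[ C ] N G z →
    ℕ→ℚ (deg G x + deg G y) ℚ.< ℕ→ℚ n ℚ.- t
theorem6 t t≥4 n n≥3 G tough ¬Ham z C C-Ham x y x≢y x∈ y∈ =
  subst (ℚ._< ℕ→ℚ n ℚ.- t) (p+q-q (ℕ→ℚ d) t) (ℚ.+-monoˡ-< (ℚ.- t)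
    (subst (ℕ→ℚ d ℚ.+ t ℚ.<_) d+[n-d] (ℚ.+-monoʳ-< (ℕ→ℚ d) (ℚ.≰⇒> n∸d≰t))))
  where
  d = deg G x + deg G y
  d+τ<n : ∀ {τ} → ℕ→ℚ τ ℚ.≤ t → 4 ≤ τ → d + τ < n
  d+τ<n τ≤t =
    successors-degree-sum< n≥3 G ¬Ham z C C-Ham x≢y x∈ y∈ (Tough⇒ToughAt {G = G} tough τ≤t)
  -- Otherwise τ = max(4, n ∸ d) is at most `t`, and d + τ < n contradicts n ≤ d + (n ∸ d).
  n∸d≰t : ¬ ℕ→ℚ (n ∸ d) ℚ.≤ t
  n∸d≰t n∸d≤t with ⊔-sel 4 (n ∸ d)
  ... | sel = <⇒≱ (d+τ<n ⊔≤t (m≤m⊔n 4 (n ∸ d)))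
      (≤-trans (m≤n+m∸n n d) (+-monoʳ-≤ d (m≤n⊔m 4 (n ∸ d))))
    where
    ⊔≤t : ℕ→ℚ (4 ⊔ (n ∸ d)) ℚ.≤ t
    ⊔≤t = [ (λ eq → subst (λ τ → ℕ→ℚ τ ℚ.≤ t) (sym eq) t≥4)
          , (λ eq → subst (λ τ → ℕ→ℚ τ ℚ.≤ t) (sym eq) n∸d≤t) ]′ sel
  d+[n-d] : ℕ→ℚ d ℚ.+ ℕ→ℚ (n ∸ d) ≡ ℕ→ℚ n
  d+[n-d] = trans (sym (ℕ→ℚ-+ d (n ∸ d)))
    -- The case τ = 4 gives d ≤ n, so the truncated subtraction is exact.
    (cong ℕ→ℚ (m+[n∸m]≡n (m+n≤o⇒m≤o d (<⇒≤ (d+τ<n t≥4 ≤-refl)))))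
  p+q-q : ∀ p q → (p ℚ.+ q) ℚ.- q ≡ p
  p+q-q p q =
    trans (ℚ.+-assoc p q (ℚ.- q)) (trans (cong (p ℚ.+_) (ℚ.+-inverseʳ q)) (ℚ.+-identityʳ p))
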